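{- For all positive integers $m$ and $N$, the modular sweep map $\mathsf{sweep}_m:\mathcal{A}\to\mathcal{A}$ is a bijection, where $\mathcal{A}$ is the set of words of length $N$ over the alphabet $\{0,1,\ldots,m-1\}$.
   Context: For a word $\mathsf{w}=\mathsf{w}_1\mathsf{w}_2\cdots\mathsf{w}_N\in\mathcal{A}$ and $1\le j\le N$, the modular level of the letter $\mathsf{w}_j$ is $\ell_j:=\left(\sum_{i=1}^{j}\mathsf{w}_i\right)\bmod m\in\{0,\ldots,m-1\}$. The modular sweep map $\mathsf{sweep}_m:\mathcal{A}\to\mathcal{A}$ is defined as follows: start with the empty word $\mathsf{u}$; for $k=m-1,m-2,\ldots,1,0$ (in this order), read $\mathsf{w}$ from right to left and append to $\mathsf{u}$ every letter $\mathsf{w}_j$ whose modular level $\ell_j$ equals $k$. Then $\mathsf{sweep}_m(\mathsf{w}):=\mathsf{u}$ (a rearrangement of the letters of $\mathsf{w}$). -}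

module Defs where

open import Data.Nat using (ℕ; zero; suc; _+_; NonZero)
open import Data.Nat.DivMod using (_%_)
open import Data.Fin using (Fin; toℕ)
open import Data.List using (List; []; _∷_; _++_; reverse; length)
open import Data.Product using (_×_; _,_; Σ; ∃-syntax)
open import Relation.Binary.PropositionalEquality using (_≡_)
open import Relation.Nullary.Decidable using (does)
open import Data.Bool using (true; false)

labelFrom : ∀ {m} → ℕ → List (Fin m) → List (Fin m × ℕ)
labelFrom s [] = []
labelFrom s (x ∷ xs) = (x , s + toℕ x) ∷ labelFrom (s + toℕ x) xs

levels : ∀ {m} .{{_ : NonZero m}} → List (Fin m) → List (Fin m × ℕ)
levels {m} w = go (labelFrom 0 w)
  where
  go : List (Fin m × ℕ) → List (Fin m × ℕ)
  go [] = []
  go ((x , s) ∷ r) = (x , s % m) ∷ go r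

withLevel : ∀ {m} → ℕ → List (Fin m × ℕ) → List (Fin m)
withLevel k [] = []
withLevel k ((x , l) ∷ r) with does (Data.Nat._≟_ l k)
... | true  = x ∷ withLevel k r
... | false = withLevel k r

descending : ∀ {A : Set} → ℕ → (ℕ → List A) → List A
descending zero f = []
descending (suc k) f = f k ++ descending k f

sweep : ∀ m .{{_ : NonZero m}} → List (Fin m) → List (Fin m)
sweep m w = descending m (λ k → withLevel k (reverse (levels w)))

IsWord : ∀ m → ℕ → List (Fin m) → Set
IsWord m N w = length w ≡ N

BijectiveOn : ∀ {A : Set} → (A → Set) → (A → A) → Set
BijectiveOn {A} P f =
  (∀ x → P x → P (f x)) ×
  (∀ x y → P x → P y → f x ≡ f y → x ≡ y) ×
  (∀ y → P y → ∃[ x ] (P x × f x ≡ y))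

{-# OPTIONS --safe #-}

-- Reading a word w from right to left, a letter x at level s leads to level s - x mod m, so w is
-- recovered from its swept word u as soon as the level of each position of u is known.  These levels
-- weakly decrease along u, and they are balanced: the sources s - x of the letters, together with the
-- final level t, form the same multiset as the levels s, together with 0.
--
-- Let a and b be the level functions of two words with the same swept word u, and c = min(a, b).
-- Balance fixes the number of letters with s < x ("wraps").  Summing, over all thresholds, the
-- inequalities between counts of sources and counts of levels shows that c has no more wraps than a;
-- so c wraps where a does, and c is balanced as well.
-- Suppose that fewer positions have c > k than a > k, where s = k + 1 is a level of a.  The first
-- letter of w reaching level s is the last one of its block in u, so c < a there; hence the source of
-- that letter decreases too, and by balance the level preceding s in w has the same defect.  Going
-- back along w ends at level 0, which has none.  So c = a, that is a ≤ b, and by symmetry a = b.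
-- Surjectivity follows since there are finitely many words of each length.

module Submission where

open import Defs
open import Data.Nat
open import Data.Nat.Properties
open import Data.Nat.DivMod using (_%_; m<n⇒m%n≡m; m%n<n; m%n%n≡m%n; [m+n]%n≡m%n; %-distribˡ-+)
open import Data.Nat.Tactic.RingSolver using (solve-∀)
open import Data.Fin as Fin using (Fin; toℕ; remQuot; combine; punchOut)
open import Data.Fin.Properties as Fin
  using (toℕ≤pred[n]; any?; injective⇒≤; punchOut-injective; remQuot-combine; combine-remQuot)
open import Data.List using (List; []; _∷_; _++_; map; reverse; reverseAcc; length; downFrom)
open import Data.List.Properties
  using (map-++; ++-assoc; ++-identityʳ; ∷-injectiveˡ; ∷-injectiveʳ; reverse-injective;
         length-reverse; length-map; length-downFrom; map-cong-local)
open import Data.List.Membership.Propositional using (_∈_)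
open import Data.List.Membership.Propositional.Properties using (∈-map⁺; ∈-downFrom⁺; ∈-downFrom⁻)
open import Data.List.Relation.Unary.Any as Any using (here; there)
open import Data.List.Relation.Unary.All as All using (All; []; _∷_)
open import Data.List.Relation.Unary.All.Properties as All using (¬Any⇒All¬)
open import Data.List.Relation.Unary.AllPairs using (AllPairs; []; _∷_)
import Data.List.Relation.Unary.AllPairs.Properties as AllPairs
open import Data.Product using (_×_; _,_; proj₁; proj₂; ∃-syntax)
open import Data.Empty using (⊥; ⊥-elim)
open import Data.Bool using (if_then_else_)
open import Function using (_∘_; const; id)
open import Function.Definitions using (Injective)
open import Relation.Nullary using (¬_; yes; no; does)
open import Relation.Nullary.Decidable using (dec-true; dec-false)
open import Relation.Binary.PropositionalEquality

-- Finite sums over lists and threshold indicators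

∑ : {A : Set} → List A → (A → ℕ) → ℕ
∑ []       f = 0
∑ (x ∷ xs) f = f x + ∑ xs f

module _ {A : Set} where

  ∑-cong : (xs : List A) {f g : A → ℕ} → (∀ {x} → x ∈ xs → f x ≡ g x) → ∑ xs f ≡ ∑ xs g
  ∑-cong []       eq = refl
  ∑-cong (x ∷ xs) eq = cong₂ _+_ (eq (here refl)) (∑-cong xs (eq ∘ there))

  ∑-mono : (xs : List A) {f g : A → ℕ} → (∀ {x} → x ∈ xs → f x ≤ g x) → ∑ xs f ≤ ∑ xs g
  ∑-mono []       le = z≤n
  ∑-mono (x ∷ xs) le = +-mono-≤ (le (here refl)) (∑-mono xs (le ∘ there))

  ∑-mono-< : (xs : List A) {f g : A → ℕ} → (∀ {x} → x ∈ xs → f x ≤ g x) →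
             ∀ {x} → x ∈ xs → f x < g x → ∑ xs f < ∑ xs g
  ∑-mono-< (x ∷ xs) le (here refl) lt = +-mono-<-≤ lt (∑-mono xs (le ∘ there))
  ∑-mono-< (x ∷ xs) le (there i)   lt = +-mono-≤-< (le (here refl)) (∑-mono-< xs (le ∘ there) i lt)

  ∑-+ : (xs : List A) (f g : A → ℕ) → ∑ xs (λ x → f x + g x) ≡ ∑ xs f + ∑ xs g
  ∑-+ []       f g = refl
  ∑-+ (x ∷ xs) f g = trans (cong (f x + g x +_) (∑-+ xs f g)) (interchange (f x) (g x) (∑ xs f) (∑ xs g))
    where
    interchange : ∀ a b c d → a + b + (c + d) ≡ a + c + (b + d)
    interchange = solve-∀

  ∑-* : (xs : List A) (c : ℕ) (f : A → ℕ) → ∑ xs (λ x → c * f x) ≡ c * ∑ xs f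
  ∑-* []       c f = sym (*-zeroʳ c)
  ∑-* (x ∷ xs) c f = trans (cong (c * f x +_) (∑-* xs c f)) (sym (*-distribˡ-+ c (f x) (∑ xs f)))

  ∑-const : (xs : List A) (c : ℕ) → ∑ xs (const c) ≡ length xs * c
  ∑-const []       c = refl
  ∑-const (x ∷ xs) c = cong (c +_) (∑-const xs c)

∑-swap : {A B : Set} (xs : List A) (ys : List B) (f : A → B → ℕ) →
         ∑ xs (λ x → ∑ ys (f x)) ≡ ∑ ys (λ y → ∑ xs (λ x → f x y))
∑-swap []       ys f = sym (trans (∑-const ys 0) (*-zeroʳ (length ys)))
∑-swap (x ∷ xs) ys f =
  trans (cong (∑ ys (f x) +_) (∑-swap xs ys f)) (sym (∑-+ ys (f x) (λ y → ∑ xs (λ z → f z y))))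

-- The indicator of `k < v` as a number, so that its sums count the entries above a threshold.
ind : ℕ → ℕ → ℕ
ind k       zero    = 0
ind zero    (suc v) = 1
ind (suc k) (suc v) = ind k v

ind-< : ∀ {k v} → k < v → ind k v ≡ 1
ind-< {zero}  (s≤s _)  = refl
ind-< {suc k} (s≤s lt) = ind-< lt

ind-≥ : ∀ {k v} → v ≤ k → ind k v ≡ 0
ind-≥         z≤n      = refl
ind-≥ {suc k} (s≤s le) = ind-≥ le

ind-mono : ∀ k {v w} → v ≤ w → ind k v ≤ ind k w
ind-mono k       z≤n            = z≤n
ind-mono zero    (s≤s _)        = ≤-refl
ind-mono (suc k) (s≤s le)       = ind-mono k le

ind-mono-< : ∀ {k v w} → v ≤ k → k < w → ind k v < ind k w
ind-mono-< v≤k k<w = subst₂ _<_ (sym (ind-≥ v≤k)) (sym (ind-< k<w)) (s≤s z≤n)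

ind-+ : ∀ k c v → ind (k + c) (v + c) ≡ ind k v
ind-+ k zero    v = cong₂ ind (+-identityʳ k) (+-identityʳ v)
ind-+ k (suc c) v = trans (cong₂ ind (+-suc k c) (+-suc v c)) (ind-+ k c v)

∑-ind : ∀ m v → v ≤ m → ∑ (downFrom m) (λ k → ind k v) ≡ v
∑-ind zero    v v≤0 = sym (n≤0⇒n≡0 v≤0)
∑-ind (suc m) v v≤1+m with m <? v
... | yes m<v with refl ← ≤-antisym v≤1+m m<v =
        cong₂ _+_ (ind-< m<v)
          (trans (∑-cong (downFrom m) (λ i → ind-< (m<n⇒m<1+n (∈-downFrom⁻ i))))
          (ones m))
  where
  ones : ∀ n → ∑ (downFrom n) (const 1) ≡ n
  ones zero    = refl
  ones (suc n) = cong suc (ones n)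
... | no m≮v = trans (cong (_+ ∑ (downFrom m) (λ k → ind k v)) (ind-≥ (≮⇒≥ m≮v))) (∑-ind m v (≮⇒≥ m≮v))

-- Along a sorted list the entries above `k` form an initial segment, both for `a` and for `b`. The
-- shorter segment lies in the longer one, and on it `a i ⊓ b i` exceeds `k`.
∑-ind-⊓ : {I : Set} (T : List I) (a b : I → ℕ) →
          AllPairs (λ i j → a j ≤ a i) T → AllPairs (λ i j → b j ≤ b i) T →
          ∀ k → ∑ T (ind k ∘ a) ⊓ ∑ T (ind k ∘ b) ≤ ∑ T (λ i → ind k (a i ⊓ b i))
∑-ind-⊓ []      a b _ _ k = z≤n
∑-ind-⊓ (i ∷ T) a b (ai ∷ aT) (bi ∷ bT) k with k <? a i | k <? b i
... | no k≮a | _ = ≤-trans (m⊓n≤m _ _) (≤-trans (≤-reflexive zeros) z≤n)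
  where
  zeros : ∑ (i ∷ T) (ind k ∘ a) ≡ 0
  zeros = trans (∑-cong (i ∷ T) {g = const 0}
                  (λ { (here refl) → ind-≥ (≮⇒≥ k≮a) ; (there j) → ind-≥ (≤-trans (All.lookup ai j) (≮⇒≥ k≮a)) }))
                (trans (∑-const T 0) (*-zeroʳ (length T)))
... | yes _ | no k≮b = ≤-trans (m⊓n≤n (∑ (i ∷ T) (ind k ∘ a)) _) (≤-trans (≤-reflexive zeros) z≤n)
  where
  zeros : ∑ (i ∷ T) (ind k ∘ b) ≡ 0
  zeros = trans (∑-cong (i ∷ T) {g = const 0}
                  (λ { (here refl) → ind-≥ (≮⇒≥ k≮b) ; (there j) → ind-≥ (≤-trans (All.lookup bi j) (≮⇒≥ k≮b)) }))
                (trans (∑-const T 0) (*-zeroʳ (length T)))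
... | yes k<a | yes k<b
  rewrite ind-< k<a | ind-< k<b | ind-< (⊓-pres-m< k<a k<b) = s≤s (∑-ind-⊓ T a b aT bT k)

-- Undoing a step modulo `suc m`

module _ (m : ℕ) where

  -- The difference s - x, shifted by the modulus so that it is not truncated for x ≤ m;
  -- the letter wraps exactly when this is at most m.
  lift : ℕ → ℕ → ℕ
  lift x s = suc m + s ∸ x

  -- The level before a letter x that ends at level s.
  source : ℕ → ℕ → ℕ
  source x s = lift x s % suc m

  source-≤ : ∀ x s → source x s ≤ m
  source-≤ x s = s≤s⁻¹ (m%n<n (lift x s) (suc m))

  lift-mono : ∀ x {s s'} → s ≤ s' → lift x s ≤ lift x s'
  lift-mono x le = ∸-monoˡ-≤ x (+-monoʳ-≤ (suc m) le)

  lift-+ : ∀ x → x ≤ m → ∀ s → lift x s + x ≡ suc m + s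
  lift-+ x x≤m s = m∸n+n≡m (≤-trans x≤m (≤-trans (n≤1+n m) (m≤m+n (suc m) s)))

  reduce-+ : ∀ {r} → r < suc m → (r + suc m) % suc m ≡ r
  reduce-+ {r} lt = trans ([m+n]%n≡m%n r (suc m)) (m<n⇒m%n≡m lt)

  -- Lifts stay below twice the modulus, so division by `suc m` has quotient 0 or 1, and this
  -- quotient is `ind m v`.
  data Residue (v : ℕ) : Set where
    low  : v ≤ m → Residue v
    high : ∀ {r} → r ≤ m → v ≡ r + suc m → Residue v

  residue : ∀ v → v < suc m + suc m → Residue v
  residue v lt with v ≤? m
  ... | yes v≤m = low v≤m
  ... | no  v≰m = high {r = v ∸ suc m} (s≤s⁻¹ (+-cancelʳ-< (suc m) _ _ (subst (_< _) (sym eq) lt))) (sym eq)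
    where
    eq : v ∸ suc m + suc m ≡ v
    eq = m∸n+n≡m (≰⇒> v≰m)

  lift-residue : ∀ {s} x → s ≤ m → Residue (lift x s)
  lift-residue {s} x s≤m =
    residue _ (≤-<-trans (m∸n≤m _ x) (+-monoʳ-< (suc m) (s≤s s≤m)))

  source-lift : ∀ x {s} → s ≤ m → source x s + suc m * ind m (lift x s) ≡ lift x s
  source-lift x {s} s≤m with lift-residue x s≤m
  ... | low v≤m rewrite ind-≥ v≤m | *-zeroʳ m | +-identityʳ (source x s) = m<n⇒m%n≡m (s≤s v≤m)
  ... | high {r} r≤m eq rewrite eq | ind-< (m≤n+m (suc m) r) | *-identityʳ m = cong (_+ suc m) (reduce-+ (s≤s r≤m))

  -- `source` is not monotone in the level, but both terms on the right are. Up to the quotient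
  -- `ind m`, counts of sources thus become monotone counts of lifts.
  source-ind : ∀ x {s k} → s ≤ m → k < suc m →
               ind k (source x s) + ind m (lift x s) ≡ ind (k + suc m) (lift x s) + ind k (lift x s)
  source-ind x {s} {k} s≤m k≤m with lift-residue x s≤m
  ... | low v≤m
    rewrite m<n⇒m%n≡m (s≤s v≤m) | ind-≥ v≤m | ind-≥ {k + suc m} (≤-trans v≤m (≤-trans (n≤1+n m) (m≤n+m (suc m) k)))
    = +-identityʳ _
  ... | high {r} r≤m eq
    rewrite eq | reduce-+ (s≤s r≤m) | ind-< (m≤n+m (suc m) r) | ind-+ k (suc m) r
          | ind-< (≤-trans k≤m (m≤n+m (suc m) r)) = refl

-- The pointwise minimum of two balanced level functions

module Meet (m t : ℕ) {I : Set} (T : List I) (x a b : I → ℕ)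
  (t≤m : t ≤ m)
  (x≤m : ∀ {i} → i ∈ T → x i ≤ m)
  (a≤m : ∀ {i} → i ∈ T → a i ≤ m)
  (b≤m : ∀ {i} → i ∈ T → b i ≤ m)
  (a-sorted : AllPairs (λ i j → a j ≤ a i) T)
  (b-sorted : AllPairs (λ i j → b j ≤ b i) T)
  -- Equality of multisets is expressed by equal sums of every test function `φ`.
  (a-balanced : ∀ φ → ∑ T (λ i → φ (source m (x i) (a i))) + φ t ≡ ∑ T (φ ∘ a) + φ 0)
  (b-balanced : ∀ φ → ∑ T (λ i → φ (source m (x i) (b i))) + φ t ≡ ∑ T (φ ∘ b) + φ 0)
  where

  c : I → ℕ
  c i = a i ⊓ b i

  c≤m : ∀ {i} → i ∈ T → c i ≤ m
  c≤m i = ≤-trans (m⊓n≤m _ _) (a≤m i)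

  src lft : (I → ℕ) → I → ℕ
  src f i = source m (x i) (f i)
  lft f i = lift m (x i) (f i)

  F G H : (I → ℕ) → ℕ → ℕ
  F f k = ∑ T (ind k ∘ f)
  G f k = ∑ T (ind k ∘ src f)
  H f k = ∑ T (ind k ∘ lft f)

  X : ℕ
  X = ∑ T x

  G+H : ∀ f → (∀ {i} → i ∈ T → f i ≤ m) → ∀ {k} → k < suc m → G f k + H f m ≡ H f (k + suc m) + H f k
  G+H f f≤m k≤m =
    trans (sym (∑-+ T _ _)) (trans (∑-cong T (λ {i} i∈ → source-ind m (x i) (f≤m i∈) k≤m)) (∑-+ T _ _))

  total : ∀ f → (∀ {i} → i ∈ T → f i ≤ m) → ∑ T (src f) + suc m * H f m + X ≡ length T * suc m + ∑ T f
  total f f≤m = begin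
    ∑ T (src f) + suc m * H f m + X
      ≡⟨ cong (λ z → ∑ T (src f) + z + X) (∑-* T (suc m) _) ⟨
    ∑ T (src f) + ∑ T (λ i → suc m * ind m (lft f i)) + X
      ≡⟨ cong (_+ X) (∑-+ T _ _) ⟨
    ∑ T (λ i → src f i + suc m * ind m (lft f i)) + X
      ≡⟨ ∑-+ T _ _ ⟨
    ∑ T (λ i → src f i + suc m * ind m (lft f i) + x i)
      ≡⟨ ∑-cong T (λ {i} i∈ → trans (cong (_+ x i) (source-lift m (x i) (f≤m i∈))) (lift-+ m (x i) (x≤m i∈) (f i))) ⟩
    ∑ T (λ i → suc m + f i)
      ≡⟨ ∑-+ T _ _ ⟩
    ∑ T (const (suc m)) + ∑ T f
      ≡⟨ cong (_+ ∑ T f) (∑-const T (suc m)) ⟩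
    length T * suc m + ∑ T f ∎
    where open ≡-Reasoning

  -- Balance at `id` cancels the sum of the sources against the sum of the levels in `total`. What
  -- remains depends on the letters and `t` alone, hence agrees for `a` and `b`.
  wraps : ∀ f → (∀ {i} → i ∈ T → f i ≤ m) →
          (∀ φ → ∑ T (φ ∘ src f) + φ t ≡ ∑ T (φ ∘ f) + φ 0) →
          suc m * H f m + X ≡ length T * suc m + t
  wraps f f≤m bal = +-cancelˡ-≡ (∑ T (src f)) _ _ (begin
    ∑ T (src f) + (suc m * H f m + X) ≡⟨ +-assoc (∑ T (src f)) _ X ⟨
    ∑ T (src f) + suc m * H f m + X   ≡⟨ total f f≤m ⟩
    length T * suc m + ∑ T f          ≡⟨ cong (length T * suc m +_) (trans (bal id) (+-identityʳ _)) ⟨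
    length T * suc m + (∑ T (src f) + t) ≡⟨ rearrange (length T * suc m) _ t ⟩
    ∑ T (src f) + (length T * suc m + t) ∎)
    where
    open ≡-Reasoning
    rearrange : ∀ p q r → p + (q + r) ≡ q + (p + r)
    rearrange = solve-∀

  -- H f m counts the letters that do not wrap.
  C : ℕ
  C = H a m

  Hb≡C : H b m ≡ C
  Hb≡C = *-cancelˡ-≡ _ _ (suc m) (+-cancelʳ-≡ X _ _ (trans (wraps b b≤m b-balanced) (sym (wraps a a≤m a-balanced))))

  Hc≤Ha : ∀ k → H c k ≤ H a k
  Hc≤Ha k = ∑-mono T (λ {i} _ → ind-mono k (lift-mono m (x i) (m⊓n≤m (a i) (b i))))

  Hc≤Hb : ∀ k → H c k ≤ H b k
  Hc≤Hb k = ∑-mono T (λ {i} _ → ind-mono k (lift-mono m (x i) (m⊓n≤n (a i) (b i))))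

  -- By `G+H` the left side consists of counts of lifts, which grow from `c` to `f`; balance of `f`
  -- then trades its sources for its levels.
  bound : ∀ f → (∀ {i} → i ∈ T → f i ≤ m) → (∀ k → H c k ≤ H f k) → H f m ≡ C →
          (∀ φ → ∑ T (φ ∘ src f) + φ t ≡ ∑ T (φ ∘ f) + φ 0) →
          ∀ {k} → k < suc m → G c k + H c m + ind k t ≤ F f k + C
  bound f f≤m Hc≤ eq bal {k} k≤m = begin
    G c k + H c m + ind k t          ≡⟨ cong (_+ ind k t) (G+H c c≤m k≤m) ⟩
    H c (k + suc m) + H c k + ind k t ≤⟨ +-monoˡ-≤ (ind k t) (+-mono-≤ (Hc≤ (k + suc m)) (Hc≤ k)) ⟩
    H f (k + suc m) + H f k + ind k t ≡⟨ cong (_+ ind k t) (G+H f f≤m k≤m) ⟨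
    G f k + H f m + ind k t          ≡⟨ cong (λ z → G f k + z + ind k t) eq ⟩
    G f k + C + ind k t              ≡⟨ rearrange (G f k) C (ind k t) ⟩
    G f k + ind k t + C              ≡⟨ cong (_+ C) (trans (bal (ind k)) (+-identityʳ _)) ⟩
    F f k + C                        ∎
    where
    open ≤-Reasoning
    rearrange : ∀ p q r → p + q + r ≡ p + r + q
    rearrange = solve-∀

  -- Sortedness enters here: the smaller of the two level counts is attained by `c`.
  bound-c : ∀ {k} → k < suc m → G c k + H c m + ind k t ≤ F c k + C
  bound-c {k} k≤m = begin
    G c k + H c m + ind k t       ≤⟨ ⊓-glb (bound a a≤m Hc≤Ha refl a-balanced k≤m) (bound b b≤m Hc≤Hb Hb≡C b-balanced k≤m) ⟩
    (F a k + C) ⊓ (F b k + C)     ≡⟨ +-distribʳ-⊓ C (F a k) (F b k) ⟨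
    F a k ⊓ F b k + C             ≤⟨ +-monoˡ-≤ C (∑-ind-⊓ T a b a-sorted b-sorted k) ⟩
    F c k + C                     ∎
    where open ≤-Reasoning

  -- Layer-cake summation: a value at most `m` is the number of thresholds below it.
  ∑-layers : ∀ (f : I → ℕ) → (∀ {i} → i ∈ T → f i ≤ m) → ∑ (downFrom m) (λ k → ∑ T (ind k ∘ f)) ≡ ∑ T f
  ∑-layers f f≤m = trans (∑-swap (downFrom m) T (λ k i → ind k (f i))) (∑-cong T (λ {i} i∈ → ∑-ind m (f i) (f≤m i∈)))

  left right : ℕ
  left  = ∑ (downFrom m) (λ k → G c k + H c m + ind k t)
  right = ∑ (downFrom m) (λ k → F c k + C)

  left≡ : left ≡ ∑ T (src c) + m * H c m + t
  left≡ = trans (∑-+ (downFrom m) _ _) (cong₂ _+_ (trans (∑-+ (downFrom m) _ _) (cong₂ _+_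
            (∑-layers (src c) (λ {i} _ → source-≤ m (x i) (c i)))
            (trans (∑-const (downFrom m) (H c m)) (cong (_* H c m) (length-downFrom m)))))
            (∑-ind m t t≤m))

  right≡ : right ≡ ∑ T c + m * C
  right≡ = trans (∑-+ (downFrom m) _ _) (cong₂ _+_ (∑-layers c c≤m)
             (trans (∑-const (downFrom m) C) (cong (_* C) (length-downFrom m))))

  -- The extra terms complete `m` thresholds to the factor `suc m` of `total` and `wraps`. As
  -- `H c m ≤ C`, this yields `right ≤ left`, while summing `bound-c` yields `left ≤ right`; so both
  -- agree and `H c m ≡ C`.
  left+Hc≡right+C : left + H c m ≡ right + C
  left+Hc≡right+C = +-cancelʳ-≡ (N + X) _ _ (begin
    left + h + (N + X)                       ≡⟨ cong (λ z → z + h + (N + X)) left≡ ⟩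
    S + m * h + t + h + (N + X)              ≡⟨ e₁ S m h t X N ⟩
    (N + t) + (S + suc m * h + X)            ≡⟨ cong₂ _+_ (sym (wraps a a≤m a-balanced)) (total c c≤m) ⟩
    (suc m * C + X) + (N + ∑ T c)            ≡⟨ e₂ m C X N (∑ T c) ⟩
    ∑ T c + m * C + C + (N + X)              ≡⟨ cong (λ z → z + C + (N + X)) right≡ ⟨
    right + C + (N + X)                      ∎)
    where
    open ≡-Reasoning
    N S h : ℕ
    N = length T * suc m
    S = ∑ T (src c)
    h = H c m
    e₁ : ∀ S m h t X N → S + m * h + t + h + (N + X) ≡ (N + t) + (S + suc m * h + X)
    e₁ = solve-∀
    e₂ : ∀ m C X N Q → (suc m * C + X) + (N + Q) ≡ Q + m * C + C + (N + X)
    e₂ = solve-∀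

  left≮right : ¬ left < right
  left≮right lt = <-irrefl left+Hc≡right+C (+-mono-<-≤ lt (Hc≤Ha m))

  Hc≡C : H c m ≡ C
  Hc≡C = ≤-antisym (Hc≤Ha m) (+-cancelˡ-≤ right _ _ (begin
    right + C     ≡⟨ left+Hc≡right+C ⟨
    left + H c m  ≤⟨ +-monoˡ-≤ (H c m) (∑-mono (downFrom m) (λ i → bound-c (m<n⇒m<1+n (∈-downFrom⁻ i)))) ⟩
    right + H c m ∎))
    where open ≤-Reasoning

  -- A failure at one threshold would make `bound-c` strict there, and so `left < right`.
  c-balanced : ∀ {k} → k < m → F c k ≤ G c k + ind k t
  c-balanced {k} k<m = ≮⇒≥ λ lt → left≮right
    (∑-mono-< (downFrom m) (λ i → bound-c (m<n⇒m<1+n (∈-downFrom⁻ i))) (∈-downFrom⁺ k<m)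
      (subst (_< F c k + C) (sym rearranged) (+-monoˡ-< C lt)))
    where
    rearrange : ∀ p q r → p + q + r ≡ p + r + q
    rearrange = solve-∀
    rearranged : G c k + H c m + ind k t ≡ G c k + ind k t + C
    rearranged = trans (rearrange (G c k) (H c m) (ind k t)) (cong (G c k + ind k t +_) Hc≡C)

  -- The indicators for `c` are pointwise at most those for `a`, and their totals agree by `Hc≡C`.
  same-wrap : ∀ {i} → i ∈ T → ind m (lft c i) ≡ ind m (lft a i)
  same-wrap {i} i∈ = ≤-antisym (le i) (≮⇒≥ λ lt → <-irrefl Hc≡C (∑-mono-< T (λ {j} _ → le j) i∈ lt))
    where
    le : ∀ j → ind m (lft c j) ≤ ind m (lft a j)
    le j = ind-mono m (lift-mono m (x j) (m⊓n≤m (a j) (b j)))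

  -- With equal quotients, passing from `a` to `c` lowers level and source by the same amount; the
  -- additive form avoids truncated subtraction.
  src-shift : ∀ {i} → i ∈ T → src c i + a i ≡ src a i + c i
  src-shift {i} i∈ = +-cancelʳ-≡ (suc m * w + x i + suc m) _ _ (begin
    src c i + a i + (suc m * w + x i + suc m) ≡⟨ e (src c i) (a i) (suc m * w) (x i) (suc m) ⟩
    (src c i + suc m * w + x i) + (suc m + a i) ≡⟨ cong₂ _+_ (eqc) (sym eqa) ⟩
    (suc m + c i) + (src a i + suc m * w + x i) ≡⟨ e′ (src a i) (c i) (suc m * w) (x i) (suc m) ⟩
    src a i + c i + (suc m * w + x i + suc m) ∎)
    where
    open ≡-Reasoning
    w : ℕ
    w = ind m (lft a i)
    eqa : src a i + suc m * w + x i ≡ suc m + a i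
    eqa = trans (cong (_+ x i) (source-lift m (x i) (a≤m i∈))) (lift-+ m (x i) (x≤m i∈) (a i))
    eqc : src c i + suc m * w + x i ≡ suc m + c i
    eqc = trans (cong (λ z → src c i + suc m * z + x i) (sym (same-wrap i∈)))
            (trans (cong (_+ x i) (source-lift m (x i) (c≤m i∈))) (lift-+ m (x i) (x≤m i∈) (c i)))
    e : ∀ p q r s n → p + q + (r + s + n) ≡ (p + r + s) + (n + q)
    e = solve-∀
    e′ : ∀ p q r s n → (n + q) + (p + r + s) ≡ p + q + (r + s + n)
    e′ = solve-∀

  src-≤ : ∀ {i} → i ∈ T → src c i ≤ src a i
  src-≤ {i} i∈ = +-cancelʳ-≤ (a i) _ _
    (subst (_≤ src a i + a i) (sym (src-shift i∈)) (+-monoʳ-≤ (src a i) (m⊓n≤m (a i) (b i))))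

  src-< : ∀ {i} → i ∈ T → c i < a i → src c i < src a i
  src-< {i} i∈ lt = +-cancelʳ-< (a i) _ _
    (subst (_< src a i + a i) (sym (src-shift i∈)) (+-monoʳ-< (src a i) lt))

  -- The reverse inequality F c k ≤ F a k always holds; level 0 is vacuously tight.
  Tight : ℕ → Set
  Tight s = ∀ k → s ≡ suc k → F a k ≤ F c k

  -- The second hypothesis is what being last in its block provides. If `k < b i`, then every
  -- position with `a` above `k` also has `b` above `k`, so `c` loses nothing.
  tight-step : ∀ {i} → i ∈ T → (∀ {j} → j ∈ T → a i ≤ a j → b i ≤ b j) → Tight (src a i) → Tight (a i)
  tight-step {i} i∈ last tight k ai≡ with k <? b i
  ... | yes k<b = ∑-mono T le
    where
    le : ∀ {j} → j ∈ T → ind k (a j) ≤ ind k (c j)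
    le {j} j∈ with k <? a j
    ... | no  k≮a = subst (_≤ ind k (c j)) (sym (ind-≥ (≮⇒≥ k≮a))) z≤n
    ... | yes k<a = ≤-reflexive (trans (ind-< k<a) (sym (ind-<
                      (⊓-pres-m< k<a (≤-trans k<b (last j∈ (subst (_≤ a j) (sym ai≡) k<a)))))))
  -- Otherwise `c i < a i`, so the source of `i` drops too, and balance turns this into a defect at
  -- level `src a i`, which is tight.
  ... | no k≮b = ⊥-elim (impossible (src a i) refl (src-< i∈ c<a))
    where
    c<a : c i < a i
    c<a = ≤-<-trans (≤-trans (m⊓n≤n (a i) (b i)) (≮⇒≥ k≮b)) (≤-reflexive (sym ai≡))
    -- The source is generalised to `s` so that its predecessor can serve as threshold; `s` is not
    -- 0, since `src c i` lies below it.
    impossible : ∀ s → src a i ≡ s → src c i < s → ⊥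
    impossible (suc k′) eq (s≤s c≤k′) = <-irrefl refl (begin-strict
      G c k′ + ind k′ t <⟨ +-monoˡ-< (ind k′ t) (∑-mono-< T (λ j∈ → ind-mono k′ (src-≤ j∈)) i∈
                             (ind-mono-< c≤k′ (≤-reflexive (sym eq)))) ⟩
      G a k′ + ind k′ t ≡⟨ trans (a-balanced (ind k′)) (+-identityʳ _) ⟩
      F a k′            ≤⟨ tight k′ eq ⟩
      F c k′            ≤⟨ c-balanced (subst (_≤ m) eq (source-≤ m (x i) (a i))) ⟩
      G c k′ + ind k′ t ∎)
      where open ≤-Reasoning

  tight⇒a≤b : (∀ {i} → i ∈ T → Tight (a i)) → ∀ {i} → i ∈ T → a i ≤ b i
  tight⇒a≤b tight {i} i∈ = ≮⇒≥ λ b<a → contra b<a (a i) refl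
    where
    contra : b i < a i → ∀ s → a i ≡ s → ⊥
    contra b<a zero    eq = n≮0 (subst (b i <_) eq b<a)
    contra b<a (suc k) eq = <⇒≱ (∑-mono-< T (λ {j} _ → ind-mono k (m⊓n≤m (a j) (b j))) i∈
      (ind-mono-< (≤-trans (m⊓n≤n (a i) (b i)) (s≤s⁻¹ (subst (b i <_) eq b<a))) (≤-reflexive (sym eq)))) (tight i∈ k eq)

-- Concatenating and filtering by level

module _ {A : Set} where

  ∑-++ : (xs ys : List A) (f : A → ℕ) → ∑ (xs ++ ys) f ≡ ∑ xs f + ∑ ys f
  ∑-++ []       ys f = refl
  ∑-++ (x ∷ xs) ys f = trans (cong (f x +_) (∑-++ xs ys f)) (sym (+-assoc (f x) _ _))

  ∑-map : {B : Set} (g : B → A) (xs : List B) (f : A → ℕ) → ∑ (map g xs) f ≡ ∑ xs (f ∘ g)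
  ∑-map g []       f = refl
  ∑-map g (x ∷ xs) f = cong (f (g x) +_) (∑-map g xs f)

  ∑-descending : ∀ n (f : ℕ → List A) (h : A → ℕ) →
                 ∑ (descending n f) h ≡ ∑ (downFrom n) (λ k → ∑ (f k) h)
  ∑-descending zero    f h = refl
  ∑-descending (suc n) f h = trans (∑-++ (f n) _ h) (cong (∑ (f n) h +_) (∑-descending n f h))

  map-descending : {B : Set} (g : A → B) (n : ℕ) (f : ℕ → List A) →
                   map g (descending n f) ≡ descending n (map g ∘ f)
  map-descending g zero    f = refl
  map-descending g (suc n) f = trans (map-++ g (f n) _) (cong (map g (f n) ++_) (map-descending g n f))

  descending-cong : ∀ n {f g : ℕ → List A} → (∀ k → f k ≡ g k) → descending n f ≡ descending n g
  descending-cong zero    eq = refl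
  descending-cong (suc n) eq = cong₂ _++_ (eq n) (descending-cong n eq)

  All-descending : {P : A → Set} (n : ℕ) {f : ℕ → List A} →
                   (∀ {k} → k < n → All P (f k)) → All P (descending n f)
  All-descending zero    all = []
  All-descending (suc n) all = All.++⁺ (all ≤-refl) (All-descending n (all ∘ m<n⇒m<1+n))

  descending-split : ∀ {k n} (f : ℕ → List A) → k < n →
                     ∃[ pre ] descending n f ≡ pre ++ f k ++ descending k f
  descending-split {k} {suc n} f k<1+n with k ≟ n
  ... | yes refl = [] , refl
  ... | no k≢n with pre , eq ← descending-split f (≤∧≢⇒< (s≤s⁻¹ k<1+n) k≢n) =
    f n ++ pre , trans (cong (f n ++_) eq) (sym (++-assoc (f n) pre _))

-- A Kronecker delta times `v`: it turns filtering by level into a sum that can be exchanged with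
-- the sum over levels.
select : ℕ → ℕ → ℕ → ℕ
select k l v = if does (l ≟ k) then v else 0

select-≡ : ∀ k v → select k k v ≡ v
select-≡ k v rewrite dec-true (k ≟ k) refl = refl

select-≢ : ∀ {k l} v → l ≢ k → select k l v ≡ 0
select-≢ {k} {l} v l≢k rewrite dec-false (l ≟ k) l≢k = refl

∑-select : ∀ n l (h : ℕ → ℕ) → l < n → ∑ (downFrom n) (λ k → select k l (h k)) ≡ h l
∑-select (suc n) l h l<1+n with l ≟ n
... | yes refl = trans (cong₂ _+_ (select-≡ l (h l)) zeros) (+-identityʳ (h l))
  where
  zeros : ∑ (downFrom l) (λ k → select k l (h k)) ≡ 0
  zeros = trans (∑-cong (downFrom l) {g = const 0} (λ k∈ → select-≢ _ (>⇒≢ (∈-downFrom⁻ k∈))))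
                (trans (∑-const (downFrom l) 0) (*-zeroʳ (length (downFrom l))))
... | no l≢n = trans (cong (_+ ∑ (downFrom n) (λ k → select k l (h k))) (select-≢ (h n) l≢n))
                     (∑-select n l h (≤∧≢⇒< (s≤s⁻¹ l<1+n) l≢n))

module _ {m : ℕ} where

  withLevel-≡ : ∀ k x (R : List (Fin m × ℕ)) → withLevel k ((x , k) ∷ R) ≡ x ∷ withLevel k R
  withLevel-≡ k x R rewrite dec-true (k ≟ k) refl = refl

  withLevel-≢ : ∀ {k l} x (R : List (Fin m × ℕ)) → l ≢ k → withLevel k ((x , l) ∷ R) ≡ withLevel k R
  withLevel-≢ {k} {l} x R l≢k rewrite dec-false (l ≟ k) l≢k = refl

  withLevel-++ : ∀ k (R S : List (Fin m × ℕ)) → withLevel k (R ++ S) ≡ withLevel k R ++ withLevel k S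
  withLevel-++ k []            S = refl
  withLevel-++ k ((x , l) ∷ R) S with l ≟ k
  ... | yes refl = trans (withLevel-≡ k x (R ++ S))
                     (trans (cong (x ∷_) (withLevel-++ k R S)) (cong (_++ _) (sym (withLevel-≡ k x R))))
  ... | no l≢k   = trans (withLevel-≢ x (R ++ S) l≢k)
                     (trans (withLevel-++ k R S) (cong (_++ _) (sym (withLevel-≢ x R l≢k))))

  withLevel-none : ∀ {k} {R : List (Fin m × ℕ)} → All (λ e → proj₂ e ≢ k) R → withLevel k R ≡ []
  withLevel-none []                         = refl
  withLevel-none {R = (x , l) ∷ R} (l≢k ∷ ≢k) = trans (withLevel-≢ x R l≢k) (withLevel-none ≢k)

  withLevel-all : ∀ k (xs : List (Fin m)) → withLevel k (map (_, k) xs) ≡ xs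
  withLevel-all k []       = refl
  withLevel-all k (x ∷ xs) = trans (withLevel-≡ k x _) (cong (x ∷_) (withLevel-all k xs))

  withLevel-All : ∀ {P : Fin m × ℕ → Set} {k} {R} → All P R → All (λ x → P (x , k)) (withLevel k R)
  withLevel-All []                 = []
  withLevel-All {P = P} {k} {(x , l) ∷ R} (p ∷ ps) with l ≟ k
  ... | yes refl = subst (All _) (sym (withLevel-≡ k x R)) (p ∷ withLevel-All {P = P} ps)
  ... | no l≢k   = subst (All _) (sym (withLevel-≢ x R l≢k)) (withLevel-All {P = P} ps)

  ∑-withLevel : ∀ k (R : List (Fin m × ℕ)) (h : Fin m → ℕ) →
                ∑ (withLevel k R) h ≡ ∑ R (λ e → select k (proj₂ e) (h (proj₁ e)))
  ∑-withLevel k []            h = refl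
  ∑-withLevel k ((x , l) ∷ R) h with l ≟ k
  ... | yes refl = trans (cong (λ z → ∑ z h) (withLevel-≡ k x R))
                     (cong₂ _+_ (sym (select-≡ k (h x))) (∑-withLevel k R h))
  ... | no l≢k   = trans (cong (λ z → ∑ z h) (withLevel-≢ x R l≢k))
                     (trans (∑-withLevel k R h) (cong (_+ _) (sym (select-≢ (h x) l≢k))))

-- The labelled swept word

block : ∀ {m} → List (Fin m × ℕ) → ℕ → List (Fin m × ℕ)
block R k = map (_, k) (withLevel k R)

-- The swept word with each letter still carrying its level.
swept : ∀ {m} → List (Fin m × ℕ) → List (Fin m × ℕ)
swept {m} R = descending m (block R)

module _ {m : ℕ} where

  map-proj₁-swept : (R : List (Fin m × ℕ)) → map proj₁ (swept R) ≡ descending m (λ k → withLevel k R)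
  map-proj₁-swept R = trans (map-descending proj₁ m (block R)) (descending-cong m λ k → unlabel k (withLevel k R))
    where
    unlabel : ∀ k (xs : List (Fin m)) → map proj₁ (map (_, k) xs) ≡ xs
    unlabel k []       = refl
    unlabel k (x ∷ xs) = cong (x ∷_) (unlabel k xs)

  block-level : ∀ (R : List (Fin m × ℕ)) k → All (λ e → proj₂ e ≡ k) (block R k)
  block-level R k = All.map⁺ (All.universal (λ _ → refl) (withLevel k R))

  descending-block-level : ∀ (R : List (Fin m × ℕ)) n → All (λ e → proj₂ e < n) (descending n (block R))
  descending-block-level R n = All-descending n (λ {k} k<n → All.map (λ { refl → k<n }) (block-level R k))

  -- Each labelled letter lands in exactly one block, so sweeping is a rearrangement; sums of
  -- arbitrary `h` express this.
  ∑-swept : {R : List (Fin m × ℕ)} → All (λ e → proj₂ e < m) R → (h : Fin m × ℕ → ℕ) → ∑ (swept R) h ≡ ∑ R h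
  ∑-swept {R} <m h = begin
    ∑ (swept R) h
      ≡⟨ ∑-descending m (block R) h ⟩
    ∑ (downFrom m) (λ k → ∑ (block R k) h)
      ≡⟨ ∑-cong (downFrom m) (λ {k} _ → trans (∑-map (_, k) (withLevel k R) h) (∑-withLevel k R _)) ⟩
    ∑ (downFrom m) (λ k → ∑ R (λ e → select k (proj₂ e) (h (proj₁ e , k))))
      ≡⟨ ∑-swap (downFrom m) R _ ⟩
    ∑ R (λ e → ∑ (downFrom m) (λ k → select k (proj₂ e) (h (proj₁ e , k))))
      ≡⟨ ∑-cong R (λ {e} e∈ → ∑-select m (proj₂ e) (λ k → h (proj₁ e , k)) (All.lookup <m e∈)) ⟩
    ∑ R h ∎
    where open ≡-Reasoning

  swept-sorted : ∀ (R : List (Fin m × ℕ)) n → AllPairs (λ e e′ → proj₂ e′ ≤ proj₂ e) (descending n (block R))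
  swept-sorted R zero    = []
  swept-sorted R (suc n) = AllPairs.++⁺ (constant (block-level R n)) (swept-sorted R n)
    (All.map (λ { refl → All.map <⇒≤ (descending-block-level R n) }) (block-level R n))
    where
    constant : ∀ {k} {S : List (Fin m × ℕ)} → All (λ e → proj₂ e ≡ k) S → AllPairs (λ e e′ → proj₂ e′ ≤ proj₂ e) S
    constant []         = []
    constant (refl ∷ eqs) = All.map ≤-reflexive eqs ∷ constant eqs

  swept-All : ∀ {P : Fin m × ℕ → Set} {R} → All P R → All P (swept R)
  swept-All {P} ps = All-descending m (λ _ → All.map⁺ (withLevel-All {P = P} ps))

  -- Only block `k` survives the filter, so the labelled swept word determines all blocks of `R`.
  withLevel-swept : ∀ (R : List (Fin m × ℕ)) {k} → k < m → withLevel k (swept R) ≡ withLevel k R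
  withLevel-swept R {k} = go m
    where
    go : ∀ n → k < n → withLevel k (descending n (block R)) ≡ withLevel k R
    go (suc n) k<1+n with k ≟ n
    ... | yes refl = begin
      withLevel k (block R k ++ descending k (block R))
        ≡⟨ withLevel-++ k (block R k) _ ⟩
      withLevel k (block R k) ++ withLevel k (descending k (block R))
        ≡⟨ cong₂ _++_ (withLevel-all k _) (withLevel-none (All.map <⇒≢ (descending-block-level R k))) ⟩
      withLevel k R ++ []
        ≡⟨ ++-identityʳ _ ⟩
      withLevel k R ∎
      where open ≡-Reasoning
    ... | no k≢n = begin
      withLevel k (block R n ++ descending n (block R))
        ≡⟨ withLevel-++ k (block R n) _ ⟩
      withLevel k (block R n) ++ withLevel k (descending n (block R))
        ≡⟨ cong₂ _++_ (withLevel-none (All.map (λ { refl → k≢n ∘ sym }) (block-level R n)))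
                      (go n (≤∧≢⇒< (s≤s⁻¹ k<1+n) k≢n)) ⟩
      withLevel k R ∎
      where open ≡-Reasoning

  -- `R` runs from right to left, so the absence of `s` in `R₁` makes `x` the first letter of the
  -- word to reach level `s`. It therefore closes its block, and only smaller levels follow.
  swept-last : ∀ R₀ x {s} R₁ → s < m → All (λ e → proj₂ e ≢ s) R₁ →
               ∃[ A ] ∃[ B ] (swept (R₀ ++ (x , s) ∷ R₁) ≡ A ++ (x , s) ∷ B × All (λ e → proj₂ e < s) B)
  swept-last R₀ x {s} R₁ s<m none with A , eq ← descending-split (block (R₀ ++ (x , s) ∷ R₁)) s<m =
    A ++ block R₀ s , descending s (block R) ,
    trans eq (trans (cong (λ z → A ++ z ++ descending s (block R)) last)
      (trans (cong (A ++_) (++-assoc (block R₀ s) _ _)) (sym (++-assoc A _ _)))) ,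
    descending-block-level R s
    where
    R : List (Fin m × ℕ)
    R = R₀ ++ (x , s) ∷ R₁
    last : block R s ≡ block R₀ s ++ (x , s) ∷ []
    last = trans (cong (map (_, s)) (trans (withLevel-++ s R₀ _)
             (cong (withLevel s R₀ ++_) (trans (withLevel-≡ s x R₁) (cong (x ∷_) (withLevel-none none))))))
             (map-++ (_, s) (withLevel s R₀) _)

-- Words as chains of levels

-- Chain t R: R lists the labelled letters of a word from right to left, and t is its final level.
data Chain {m : ℕ} : ℕ → List (Fin (suc m) × ℕ) → Set where
  start : Chain 0 []
  step  : ∀ {p s x R} → Chain p R → s ≡ (p + toℕ x) % suc m → Chain s ((x , s) ∷ R)

module _ {m : ℕ} where

  chain-≤ : ∀ {t} {R : List (Fin (suc m) × ℕ)} → Chain t R → t ≤ m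
  chain-≤ start                       = z≤n
  chain-≤ (step {p} {x = x} _ refl) = s≤s⁻¹ (m%n<n (p + toℕ x) (suc m))

  chain-levels-< : ∀ {t} {R : List (Fin (suc m) × ℕ)} → Chain t R → All (λ e → proj₂ e < suc m) R
  chain-levels-< start          = []
  chain-levels-< ch@(step c _)  = s≤s (chain-≤ ch) ∷ chain-levels-< c

  -- If `p + x ≤ m`, the lift is `p` plus the modulus; otherwise the sum has lost one modulus and
  -- the lift is `p` itself.
  source-+ : ∀ {p x} → p ≤ m → x ≤ m → source m x ((p + x) % suc m) ≡ p
  source-+ {p} {x} p≤m x≤m with residue m (p + x) (+-mono-< (s≤s p≤m) (s≤s x≤m))
  ... | low v≤m rewrite m<n⇒m%n≡m (s≤s v≤m) | sym (+-assoc (suc m) p x) | m+n∸n≡m (suc m + p) x | +-comm (suc m) p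
    = reduce-+ m (s≤s p≤m)
  ... | high {r} r≤m eq
    rewrite eq | reduce-+ m (s≤s r≤m) | +-comm (suc m) r | sym eq | m+n∸n≡m p x = m<n⇒m%n≡m (s≤s p≤m)

  chain-source : ∀ {p s} {x : Fin (suc m)} {R : List (Fin (suc m) × ℕ)} → Chain p R → s ≡ (p + toℕ x) % suc m →
                 source m (toℕ x) s ≡ p
  chain-source {x = x} c refl = source-+ (chain-≤ c) (toℕ≤pred[n] x)

  -- Each source is the preceding level, so sources and levels differ only at the two ends of the
  -- chain.
  chain-balanced : ∀ {t} {R : List (Fin (suc m) × ℕ)} → Chain t R → (φ : ℕ → ℕ) →
                   ∑ R (λ e → φ (source m (toℕ (proj₁ e)) (proj₂ e))) + φ t ≡ ∑ R (φ ∘ proj₂) + φ 0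
  chain-balanced start φ = refl
  chain-balanced (step {p} {s} {x} {R} c eq) φ = begin
    φ (source m (toℕ x) s) + S + φ s ≡⟨ +-comm _ (φ s) ⟩
    φ s + (φ (source m (toℕ x) s) + S) ≡⟨ cong (λ z → φ s + (φ z + S)) (chain-source c eq) ⟩
    φ s + (φ p + S)                  ≡⟨ cong (φ s +_) (trans (+-comm (φ p) S) (chain-balanced c φ)) ⟩
    φ s + (∑ R (φ ∘ proj₂) + φ 0)    ≡⟨ +-assoc (φ s) _ (φ 0) ⟨
    φ s + ∑ R (φ ∘ proj₂) + φ 0      ∎
    where
    open ≡-Reasoning
    S : ℕ
    S = ∑ R (λ e → φ (source m (toℕ (proj₁ e)) (proj₂ e)))

  %-+ : ∀ s x → (s % suc m + x) % suc m ≡ (s + x) % suc m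
  %-+ s x = begin
    (s % suc m + x) % suc m                    ≡⟨ %-distribˡ-+ (s % suc m) x (suc m) ⟩
    (s % suc m % suc m + x % suc m) % suc m    ≡⟨ cong (λ z → (z + x % suc m) % suc m) (m%n%n≡m%n s (suc m)) ⟩
    (s % suc m + x % suc m) % suc m            ≡⟨ %-distribˡ-+ s x (suc m) ⟨
    (s + x) % suc m                            ∎
    where open ≡-Reasoning

  -- This makes the final level readable from the letters in any order, in particular from the swept
  -- word.
  chain-total : ∀ {t} {R : List (Fin (suc m) × ℕ)} → Chain t R → t ≡ ∑ R (toℕ ∘ proj₁) % suc m
  chain-total start = refl
  chain-total (step {p} {x = x} {R} c refl) =
    trans (cong (λ z → (z + toℕ x) % suc m) (chain-total c))
      (trans (%-+ (∑ R (toℕ ∘ proj₁)) (toℕ x)) (cong (_% suc m) (+-comm _ (toℕ x))))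

  -- The current level selects a block, the head of that block is the next letter from the right,
  -- and its source is the next level.
  chain-injective : ∀ {t} {R R′ : List (Fin (suc m) × ℕ)} → Chain t R → Chain t R′ →
                    (∀ {k} → k < suc m → withLevel k R ≡ withLevel k R′) → R ≡ R′
  chain-injective start start same = refl
  chain-injective start (step {s = s} {x} {R′} _ _) same with () ← trans (same (s≤s z≤n)) (withLevel-≡ s x R′)
  chain-injective (step {s = s} {x} {R} _ _) start same with () ← trans (sym (same (s≤s z≤n))) (withLevel-≡ s x R)
  chain-injective ch@(step {p} {s} {x} {R} c eq) (step {p′} {x = x′} {R′} c′ eq′) same
    with heads ← trans (sym (withLevel-≡ s x R)) (trans (same (s≤s (chain-≤ ch))) (withLevel-≡ s x′ R′))
    with refl ← ∷-injectiveˡ heads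
    with refl ← trans (sym (chain-source c eq)) (chain-source c′ eq′)
    = cong ((x , s) ∷_) (chain-injective c c′ rest)
    where
    rest : ∀ {k} → k < suc m → withLevel k R ≡ withLevel k R′
    rest {k} k<m with s ≟ k
    ... | yes refl = ∷-injectiveʳ heads
    ... | no s≢k   = trans (sym (withLevel-≢ x R s≢k)) (trans (same k<m) (withLevel-≢ x R′ s≢k))

-- The levels of a word form a chain

mod-level : ∀ {m} → Fin (suc m) × ℕ → Fin (suc m) × ℕ
mod-level {m} (x , s) = x , s % suc m

mutual

  levels-map : ∀ {m} (w : List (Fin (suc m))) →
               levels w ≡ map mod-level (labelFrom 0 w)
  -- Abstracting the labelled list leaves the local function applied to a variable, so that
  -- unification can solve the left-hand side of `levels-go`.
  levels-map w with labelFrom 0 w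
  ... | L = levels-go w L

  -- The left-hand side is the local function of levels, which has no name of its own;
  -- levels-map determines it.
  levels-go : ∀ {m} (w : List (Fin (suc m))) (L : List (Fin (suc m) × ℕ)) →
              _ ≡ map mod-level L
  levels-go w []      = refl
  levels-go w (e ∷ L) = cong (_ ∷_) (levels-go w L)

module _ {m : ℕ} where

  levels-chain : (w : List (Fin (suc m))) → ∃[ t ] Chain t (reverse (levels w))
  levels-chain w rewrite levels-map w = go 0 w [] start
    where
    -- The accumulator of `reverse` is the prefix read so far, backwards, and hence a chain ending
    -- at the current level.
    go : ∀ s (w : List (Fin (suc m))) acc → Chain (s % suc m) acc →
         ∃[ t ] Chain t (reverseAcc acc (map mod-level (labelFrom s w)))
    go s []      acc c = s % suc m , c
    go s (x ∷ w) acc c = go (s + toℕ x) w _ (step c (sym (%-+ s (toℕ x))))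

  map-proj₁-levels : (w : List (Fin (suc m))) → map proj₁ (levels w) ≡ w
  map-proj₁-levels w rewrite levels-map w = go 0 w
    where
    go : ∀ s (w : List (Fin (suc m))) → map proj₁ (map mod-level (labelFrom s w)) ≡ w
    go s []      = refl
    go s (x ∷ w) = cong (x ∷_) (go (s + toℕ x) w)

-- Comparing two labellings of one swept word

Position : ℕ → Set
Position m = Fin (suc m) × ℕ × ℕ

labelled₁ labelled₂ : ∀ {m} → Position m → Fin (suc m) × ℕ
labelled₁ (x , a , b) = x , a
labelled₂ (x , a , b) = x , b

-- Provides the common list of positions over which `Meet` compares two level functions.
superpose : ∀ {m} (P Q : List (Fin (suc m) × ℕ)) → map proj₁ P ≡ map proj₁ Q →
            ∃[ T ] (map labelled₁ T ≡ P × map labelled₂ T ≡ Q)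
superpose []            []            eq = [] , refl , refl
superpose ((x , a) ∷ P) ((y , b) ∷ Q) eq
  with refl ← ∷-injectiveˡ eq | T , refl , refl ← superpose P Q (∷-injectiveʳ eq)
  = (x , a , b) ∷ T , refl , refl

All-map⁻-∈ : {A B : Set} {P : B → Set} (f : A → B) {xs : List A} {ys : List B} →
             map f xs ≡ ys → All P ys → ∀ {x} → x ∈ xs → P (f x)
All-map⁻-∈ f refl all x∈ = All.lookup all (∈-map⁺ f x∈)

-- Turns a splitting around `e` into the second hypothesis of `tight-step`: earlier positions have
-- at least as large a `b` by sortedness, later ones have too small an `a`.
last-position : {I A : Set} (f : I → A) (a : A → ℕ) (b : I → ℕ) {T : List I} →
                AllPairs (λ i j → b j ≤ b i) T →
                ∀ P {e Q} → map f T ≡ P ++ e ∷ Q → All (λ e′ → a e′ < a e) Q →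
                ∃[ i ] (i ∈ T × f i ≡ e × (∀ {j} → j ∈ T → a e ≤ a (f j) → b i ≤ b j))
last-position f a b {i ∷ T} sorted [] refl small = i , here refl , refl , λ
  { (here refl) _  → ≤-refl
  ; (there j∈)  le → ⊥-elim (<⇒≱ (All-map⁻-∈ {P = λ e′ → a e′ < a (f i)} f refl small j∈) le) }
last-position f a b {i ∷ T} (bi ∷ sorted) (_ ∷ P) eq small
  with k , k∈ , fk≡e , last ← last-position f a b sorted P (∷-injectiveʳ eq) small
  = k , there k∈ , fk≡e , λ
  { (here refl) _  → All.lookup bi k∈
  ; (there j∈)  le → last j∈ le }

module _ {m t : ℕ} (T : List (Position m)) where

  transport-balance : {R : List (Fin (suc m) × ℕ)} (f : Position m → Fin (suc m) × ℕ) →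
                      Chain t R → map f T ≡ swept R → (φ : ℕ → ℕ) →
                      ∑ T (λ i → φ (source m (toℕ (proj₁ (f i))) (proj₂ (f i)))) + φ t ≡ ∑ T (λ i → φ (proj₂ (f i))) + φ 0
  transport-balance {R} f c eq φ =
    trans (cong (_+ φ t) (move (λ e → φ (source m (toℕ (proj₁ e)) (proj₂ e)))))
      (trans (chain-balanced c φ) (cong (_+ φ 0) (sym (move (φ ∘ proj₂)))))
    where
    move : (h : Fin (suc m) × ℕ → ℕ) → ∑ T (h ∘ f) ≡ ∑ R h
    move h = trans (sym (∑-map f T h)) (trans (cong (λ z → ∑ z h) eq) (∑-swept (chain-levels-< c) h))

  transport-≤ : (R : List (Fin (suc m) × ℕ)) (f : Position m → Fin (suc m) × ℕ) →
                map f T ≡ swept R → ∀ {i} → i ∈ T → proj₂ (f i) ≤ m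
  transport-≤ R f eq i∈ =
    s≤s⁻¹ (All-map⁻-∈ {P = λ e → proj₂ e < suc m} f eq (descending-block-level R (suc m)) i∈)

  transport-sorted : (R : List (Fin (suc m) × ℕ)) (f : Position m → Fin (suc m) × ℕ) →
                     map f T ≡ swept R → AllPairs (λ i j → proj₂ (f j) ≤ proj₂ (f i)) T
  transport-sorted R f eq = AllPairs.map⁻ (subst (AllPairs _) (sym eq) (swept-sorted R (suc m)))

  -- Generic in the two projections, so that it applies again with the roles exchanged.
  module Compare {R R′ : List (Fin (suc m) × ℕ)} (f f′ : Position m → Fin (suc m) × ℕ)
    (same-letter : ∀ i → proj₁ (f i) ≡ proj₁ (f′ i))
    (c : Chain t R) (c′ : Chain t R′) (eq : map f T ≡ swept R) (eq′ : map f′ T ≡ swept R′) where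

    open Meet m t T (toℕ ∘ proj₁ ∘ f) (proj₂ ∘ f) (proj₂ ∘ f′)
      (chain-≤ c) (λ {i} _ → toℕ≤pred[n] (proj₁ (f i))) (transport-≤ R f eq) (transport-≤ R′ f′ eq′)
      (transport-sorted R f eq) (transport-sorted R′ f′ eq′)
      (transport-balance f c eq)
      (λ φ → trans (cong (_+ φ t) (∑-cong T (λ {i} _ → cong (λ z → φ (source m (toℕ z) (proj₂ (f′ i)))) (same-letter i))))
                   (transport-balance f′ c′ eq′ φ))
      using (Tight; tight-step; tight⇒a≤b)

    -- Induction from the first letter of the word, at the end of `R`; `R₀` keeps the later letters
    -- because `swept-last` speaks of the whole `R`.
    tight-suffix : ∀ R₀ {s R₁} → R ≡ R₀ ++ R₁ → Chain s R₁ → Tight s × All (Tight ∘ proj₂) R₁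
    tight-suffix R₀ R≡ start = (λ _ ()) , []
    tight-suffix R₀ R≡ ch@(step {p} {s} {x} {R₁} c₁ eq₁)
      with tight-p , tight-R₁ ← tight-suffix (R₀ ++ (x , s) ∷ []) (trans R≡ (sym (++-assoc R₀ _ _))) c₁
      = tight-s , tight-s ∷ tight-R₁
      where
      tight-s : Tight s
      tight-s with Any.any? (λ e → proj₂ e ≟ s) R₁
      -- The level was reached earlier in the word, where it is already known to be tight.
      ... | yes found with tight , level≡ ← All.lookupAny tight-R₁ found = subst Tight level≡ tight
      ... | no none
        with A , B , swept≡ , small ← swept-last R₀ x R₁ (s≤s (chain-≤ ch)) (¬Any⇒All¬ R₁ none)
        with i , i∈ , fi≡ , last ← last-position f proj₂ (proj₂ ∘ f′) (transport-sorted R′ f′ eq′) A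
                                     (trans eq (trans (cong swept R≡) swept≡)) small
        = subst Tight (cong proj₂ fi≡) (tight-step i∈
            (λ j∈ le → last j∈ (subst (_≤ _) (cong proj₂ fi≡) le))
            (subst Tight (sym (trans (cong (λ e → source m (toℕ (proj₁ e)) (proj₂ e)) fi≡) (chain-source c₁ eq₁))) tight-p))

    levels-≤ : ∀ {i} → i ∈ T → proj₂ (f i) ≤ proj₂ (f′ i)
    levels-≤ = tight⇒a≤b (All-map⁻-∈ {P = Tight ∘ proj₂} f eq
                (swept-All {P = Tight ∘ proj₂} (proj₂ (tight-suffix [] refl c))))

-- Injectivity of the sweep map

module _ {m : ℕ} where

  sum-swept : ∀ {t} {R : List (Fin (suc m) × ℕ)} → Chain t R → t ≡ ∑ (map proj₁ (swept R)) toℕ % suc m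
  sum-swept {R = R} c = trans (chain-total c) (cong (_% suc m)
    (sym (trans (∑-map proj₁ (swept R) toℕ) (∑-swept (chain-levels-< c) (toℕ ∘ proj₁)))))

  swept-unique : ∀ {t t′} {R R′ : List (Fin (suc m) × ℕ)} → Chain t R → Chain t′ R′ →
                 map proj₁ (swept R) ≡ map proj₁ (swept R′) → R ≡ R′
  swept-unique {R = R} {R′} c c′ letters
    -- The final levels agree, both being the sum of the common letters modulo `suc m`.
    with refl ← trans (sum-swept c) (trans (cong (λ z → ∑ z toℕ % suc m) letters) (sym (sum-swept c′)))
    with T , eq , eq′ ← superpose (swept R) (swept R′) letters
    = chain-injective c c′ λ {k} k<m → trans (sym (withLevel-swept R k<m))
        (trans (cong (withLevel k) same) (withLevel-swept R′ k<m))
    where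
    module ₁₂ = Compare T labelled₁ labelled₂ (λ _ → refl) c c′ eq eq′
    module ₂₁ = Compare T labelled₂ labelled₁ (λ _ → refl) c′ c eq′ eq
    same-labels : ∀ {i} → i ∈ T → labelled₁ i ≡ labelled₂ i
    same-labels {x , a , b} i∈ = cong (x ,_) (≤-antisym (₁₂.levels-≤ i∈) (₂₁.levels-≤ i∈))
    same : swept R ≡ swept R′
    same = trans (sym eq) (trans (map-cong-local (All.tabulate same-labels)) eq′)

  sweep≡ : (w : List (Fin (suc m))) → map proj₁ (swept (reverse (levels w))) ≡ sweep (suc m) w
  sweep≡ w = map-proj₁-swept (reverse (levels w))

  sweep-injective : Injective _≡_ _≡_ (sweep (suc m))
  sweep-injective {w} {w′} eq = trans (sym (map-proj₁-levels w)) (trans (cong (map proj₁) same) (map-proj₁-levels w′))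
    where
    same : levels w ≡ levels w′
    same = reverse-injective (swept-unique (proj₂ (levels-chain w)) (proj₂ (levels-chain w′))
             (trans (sweep≡ w) (trans eq (sym (sweep≡ w′)))))

  length-sweep : (w : List (Fin (suc m))) → length (sweep (suc m) w) ≡ length w
  length-sweep w = begin
    length (sweep (suc m) w)           ≡⟨ cong length (sweep≡ w) ⟨
    length (map proj₁ (swept R))       ≡⟨ length-map proj₁ (swept R) ⟩
    length (swept R)                   ≡⟨ length≡∑ (swept R) ⟩
    ∑ (swept R) (const 1)              ≡⟨ ∑-swept (chain-levels-< (proj₂ (levels-chain w))) (const 1) ⟩
    ∑ R (const 1)                      ≡⟨ length≡∑ R ⟨
    length R                           ≡⟨ length-reverse (levels w) ⟩
    length (levels w)                  ≡⟨ length-map proj₁ (levels w) ⟨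
    length (map proj₁ (levels w))      ≡⟨ cong length (map-proj₁-levels w) ⟩
    length w                           ∎
    where
    open ≡-Reasoning
    R : List (Fin (suc m) × ℕ)
    R = reverse (levels w)
    length≡∑ : {A : Set} (xs : List A) → length xs ≡ ∑ xs (const 1)
    length≡∑ xs = sym (trans (∑-const xs 1) (*-identityʳ (length xs)))

-- From injectivity to surjectivity on words of fixed length

Fin-injective⇒surjective : ∀ {n} {f : Fin n → Fin n} → Injective _≡_ _≡_ f → ∀ y → ∃[ x ] f x ≡ y
Fin-injective⇒surjective {suc n} {f} inj y with any? (λ x → f x Fin.≟ y)
... | yes hit = hit
-- Removing a missed `y` from the codomain would inject `Fin (suc n)` into `Fin n`.
... | no miss = ⊥-elim (1+n≰n (injective⇒≤ {f = λ x → punchOut (miss-at x)}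
                  λ {x} {x′} eq → inj (punchOut-injective (miss-at x) (miss-at x′) eq)))
  where
  miss-at : ∀ x → y ≢ f x
  miss-at x eq = miss (x , sym eq)

module _ {m : ℕ} where

  -- Reads a word as the base `m` digits of a number, leading digit first.
  encode : ∀ N (w : List (Fin m)) → length w ≡ N → Fin (m ^ N)
  encode zero    []      eq = Fin.zero
  encode (suc N) (x ∷ w) eq = combine x (encode N w (suc-injective eq))

  decode : ∀ N → Fin (m ^ N) → List (Fin m)
  decode zero    i = []
  decode (suc N) i = proj₁ (remQuot {m} (m ^ N) i) ∷ decode N (proj₂ (remQuot {m} (m ^ N) i))

  length-decode : ∀ N i → length (decode N i) ≡ N
  length-decode zero    i = refl
  length-decode (suc N) i = cong suc (length-decode N _)

  decode-encode : ∀ N w (eq : length w ≡ N) → decode N (encode N w eq) ≡ w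
  decode-encode zero    []      eq = refl
  decode-encode (suc N) (x ∷ w) eq
    = trans (cong (λ e → proj₁ e ∷ decode N (proj₂ e)) (remQuot-combine {m} {m ^ N} x (encode N w (suc-injective eq))))
            (cong (x ∷_) (decode-encode N w (suc-injective eq)))

  decode-injective : ∀ N → Injective _≡_ _≡_ (decode N)
  decode-injective zero    {Fin.zero} {Fin.zero} eq = refl
  decode-injective (suc N) {i} {j} eq = begin
    i                                              ≡⟨ combine-remQuot {m} (m ^ N) i ⟨
    combine (proj₁ (remQuot {m} (m ^ N) i)) (proj₂ (remQuot {m} (m ^ N) i))
      ≡⟨ cong₂ combine (∷-injectiveˡ eq) (decode-injective N (∷-injectiveʳ eq)) ⟩
    combine (proj₁ (remQuot {m} (m ^ N) j)) (proj₂ (remQuot {m} (m ^ N) j))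
      ≡⟨ combine-remQuot {m} (m ^ N) j ⟩
    j                                              ∎
    where open ≡-Reasoning

  words-injective⇒surjective : ∀ {N} {f : List (Fin m) → List (Fin m)} → (∀ w → length (f w) ≡ length w) →
                               Injective _≡_ _≡_ f → ∀ u → length u ≡ N → ∃[ w ] (length w ≡ N × f w ≡ u)
  words-injective⇒surjective {N} {f} length-f inj u |u|≡N =
    preimage (Fin-injective⇒surjective g-injective (encode N u |u|≡N))
    where
    |f| : ∀ i → length (f (decode N i)) ≡ N
    |f| i = trans (length-f (decode N i)) (length-decode N i)
    g : Fin (m ^ N) → Fin (m ^ N)
    g i = encode N (f (decode N i)) (|f| i)
    g-injective : Injective _≡_ _≡_ g
    g-injective {i} {j} eq = decode-injective N (inj (trans (sym (decode-encode N _ (|f| i)))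
                               (trans (cong (decode N) eq) (decode-encode N _ (|f| j)))))
    preimage : ∃[ i ] g i ≡ encode N u |u|≡N → ∃[ w ] (length w ≡ N × f w ≡ u)
    preimage (i , eq) = decode N i , length-decode N i ,
      trans (sym (decode-encode N _ (|f| i))) (trans (cong (decode N) eq) (decode-encode N u |u|≡N))

theorem1p4 : (m N : ℕ) → BijectiveOn (IsWord (suc m) (suc N)) (sweep (suc m))
theorem1p4 m N =
  (λ w |w| → trans (length-sweep w) |w|) ,
  (λ w w′ _ _ → sweep-injective) ,
  words-injective⇒surjective length-sweep sweep-injective
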